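{- There is a universal constant $c>0$ such that for every length $n$ and every integer $\delta\in[2\mathinner{.\,.} n]$ there exists a string $S[1\mathinner{.\,.} n]$ with $\delta(S)=\delta$ and $\gamma(S)\ge c\,\delta\log\frac{n}{\delta}$.
   Context: For a string $S$ of length $n$ and $k\in[1\mathinner{.\,.} n]$, $d_k(S)$ denotes the number of distinct length-$k$ substrings of $S$, and $\delta(S)=\max\{d_k(S)/k : k\in[1\mathinner{.\,.} n]\}$. An attractor of $S[1\mathinner{.\,.} n]$ is a set $\Gamma\subseteq[1\mathinner{.\,.} n]$ such that every substring $S[i\mathinner{.\,.} j]$ has an occurrence $S[i'\mathinner{.\,.} j']=S[i\mathinner{.\,.} j]$ with $\Gamma\cap[i'\mathinner{.\,.} j']\neq\emptyset$; $\gamma(S)$ is the minimum size of an attractor of $S$. The alphabet may be chosen freely (of size polynomial in $n$). Logarithms are base 2. -}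

module Defs where

open import Data.Nat using (ℕ; suc; _∸_; _+_; _*_; _≤_; _<_)
open import Data.Nat.Properties using (_≟_)
open import Data.Fin using (Fin; toℕ)
open import Data.Fin.Subset using (Subset; _∈_)
open import Data.List using (List; length; map; upTo; take; drop; deduplicate)
import Data.List.Properties as LP
open import Data.Vec using (Vec; toList)
open import Data.Product using (Σ; ∃; _×_)
open import Relation.Binary.PropositionalEquality using (_≡_)

-- Strings over the alphabet ℕ; positions are 0-indexed.

sub : ∀ {n} → Vec ℕ n → ℕ → ℕ → List ℕ
sub S i len = take len (drop i (toList S))

d : ∀ {n} → ℕ → Vec ℕ n → ℕ
d {n} k S = length (deduplicate (LP.≡-dec _≟_) (map (λ i → sub S i k) (upTo (suc (n ∸ k)))))

-- δ(S) = δ, i.e. max { d_k(S)/k : k ∈ [1..n] } = δ (unfolded: upper bound attained).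
HasDelta : ∀ {n} → Vec ℕ n → ℕ → Set
HasDelta {n} S δ =
  (∀ k → 1 ≤ k → k ≤ n → d k S ≤ δ * k) ×
  (∃ λ k → 1 ≤ k × k ≤ n × d k S ≡ δ * k)

IsAttractor : ∀ {n} → Vec ℕ n → Subset n → Set
IsAttractor {n} S Γ =
  ∀ (i len : ℕ) → 1 ≤ len → i + len ≤ n →
    ∃ λ i' → i' + len ≤ n × sub S i' len ≡ sub S i len ×
      ∃ λ (p : Fin n) → p ∈ Γ × i' ≤ toℕ p × toℕ p < i' + len

{-# OPTIONS --safe #-}
-- Over the letters 0 .. δ-1 with δ = e + 2, take the word that starts with the
-- e letters 2 .. δ-1 and continues with nonzero markers separated by runs of 0.
-- The markers cycle through the letters 1 .. m, where m = 1 + ⌊e / 3⌋, and the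
-- distance to the next marker doubles after every cycle.  A factor of length k
-- starting beyond e + (2m-1)(k-2) sees at most one marker, which leaves at most
-- 1 + e + (2m-1)(k-2) + mk ≤ δk factors of length k; for k = 1 there are exactly δ.
-- A factor running from one marker to the next determines the letter and the
-- gap, hence occurs only once, so an attractor meets every second one of these
-- pairwise disjoint factors.  About m log (n / δ) markers fit into length n.
module Submission where

open import Defs
open import Data.Nat using (ℕ; zero; suc; _+_; _*_; _^_; _∸_; _≤_; _<_;
  z≤n; s≤s; z<s; _/_; _%_; _<?_; ⌊_/2⌋; ⌈_/2⌉; >-nonZero)
open import Data.Nat.Properties
open import Data.Nat.DivMod
open import Data.Nat.Divisibility using (n∣m*n)
open import Data.Nat.Tactic.RingSolver using (solve-∀)
open import Data.Fin using (Fin; toℕ)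
open import Data.List using (List; []; _∷_; [_]; length; map; upTo; applyUpTo;
  take; drop; deduplicate; cartesianProductWith; _++_)
open import Data.List.Properties using (length-map; length-upTo; length-applyUpTo;
  length-++; ∷-injective; ∷-injectiveˡ; ≡-dec)
open import Data.List.Membership.Propositional as List using ()
open import Data.List.Membership.Propositional.Properties
open import Data.List.Relation.Unary.All as All using ()
open import Data.List.Relation.Unary.AllPairs using ([]; _∷_)
open import Data.List.Relation.Unary.Any using (here; there)
open import Data.List.Relation.Unary.Unique.Propositional using (Unique)
import Data.List.Relation.Unary.Unique.Propositional.Properties as Unique
open import Data.List.Relation.Unary.Unique.DecPropositional.Properties using (deduplicate-!)
open import Data.Vec using (Vec; toList; tabulate)
open import Data.Fin.Subset using (Subset; ∣_∣; _∈_; _-_)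
open import Data.Fin.Subset.Properties using (x∈p⇒∣p-x∣<∣p∣; x∈p∧x≢y⇒x∈p-y)
open import Data.Product using (∃; ∃₂; _×_; _,_; proj₁; proj₂)
open import Data.Sum using (inj₁; inj₂)
open import Function using (_∘_)
open import Relation.Nullary using (yes; no; contradiction)
open import Relation.Binary using (tri<; tri≈; tri>)
open import Relation.Binary.PropositionalEquality hiding ([_])

-- Lengths of lists and words given by a function.

-- Cutting one copy of the head out of `ys` loses nothing that the tail needs, because the tail
-- avoids the head.
unique-⊆⇒length≤ : ∀ {A : Set} {xs ys : List A} → Unique xs →
  (∀ {x} → x List.∈ xs → x List.∈ ys) → length xs ≤ length ys
unique-⊆⇒length≤ [] xs⊆ys = z≤n
unique-⊆⇒length≤ {xs = x ∷ xs} (x∉xs ∷ xs!) xs⊆ys with ∈-∃++ (xs⊆ys (here refl))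
... | as , bs , refl = begin
  suc (length xs)              ≤⟨ s≤s (unique-⊆⇒length≤ xs! xs⊆as++bs) ⟩
  suc (length (as ++ bs))      ≡⟨ cong suc (length-++ as) ⟩
  suc (length as + length bs)  ≡⟨ +-suc (length as) (length bs) ⟨
  length as + suc (length bs)  ≡⟨ length-++ as ⟨
  length (as ++ [ x ] ++ bs)   ∎
  where
  open ≤-Reasoning
  xs⊆as++bs : ∀ {y} → y List.∈ xs → y List.∈ as ++ bs
  xs⊆as++bs y∈xs with ∈-++⁻ as (xs⊆ys (there y∈xs))
  ... | inj₁ y∈as         = ∈-++⁺ˡ y∈as
  ... | inj₂ (here y≡x)   = contradiction (sym y≡x) (All.lookup x∉xs y∈xs)
  ... | inj₂ (there y∈bs) = ∈-++⁺ʳ as y∈bs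

length-cartesianProductWith : ∀ {A B C : Set} (f : A → B → C) xs ys →
  length (cartesianProductWith f xs ys) ≡ length xs * length ys
length-cartesianProductWith f []       ys = refl
length-cartesianProductWith f (x ∷ xs) ys = trans (length-++ (map (f x) ys))
  (cong₂ _+_ (length-map (f x) ys) (length-cartesianProductWith f xs ys))

applyUpTo-cong : ∀ {A : Set} {f g : ℕ → A} n → (∀ i → i < n → f i ≡ g i) →
  applyUpTo f n ≡ applyUpTo g n
applyUpTo-cong zero    f≗g = refl
applyUpTo-cong (suc n) f≗g =
  cong₂ _∷_ (f≗g 0 z<s) (applyUpTo-cong n (λ i i<n → f≗g (suc i) (s≤s i<n)))

applyUpTo-injective : ∀ {A : Set} {f g : ℕ → A} n → applyUpTo f n ≡ applyUpTo g n →
  ∀ i → i < n → f i ≡ g i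
applyUpTo-injective (suc n) eq zero    _         = ∷-injectiveˡ eq
applyUpTo-injective (suc n) eq (suc i) (s≤s i<n) =
  applyUpTo-injective n (proj₂ (∷-injective eq)) i i<n

take-applyUpTo : ∀ {A : Set} (f : ℕ → A) {k n} → k ≤ n → take k (applyUpTo f n) ≡ applyUpTo f k
take-applyUpTo f z≤n       = refl
take-applyUpTo f (s≤s k≤n) = cong (f 0 ∷_) (take-applyUpTo (f ∘ suc) k≤n)

take-drop-applyUpTo : ∀ {A : Set} (f : ℕ → A) i {k n} → i + k ≤ n →
  take k (drop i (applyUpTo f n)) ≡ applyUpTo (λ o → f (i + o)) k
take-drop-applyUpTo f zero    le       = take-applyUpTo f le
take-drop-applyUpTo f (suc i) (s≤s le) = take-drop-applyUpTo (f ∘ suc) i le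

toList-tabulate : ∀ {A : Set} (f : ℕ → A) n → toList (tabulate {n = n} (f ∘ toℕ)) ≡ applyUpTo f n
toList-tabulate f zero    = refl
toList-tabulate f (suc n) = cong (f 0 ∷_) (toList-tabulate (f ∘ suc) n)

sub-tabulate : ∀ (f : ℕ → ℕ) n i k → i + k ≤ n →
  sub (tabulate {n = n} (f ∘ toℕ)) i k ≡ applyUpTo (λ o → f (i + o)) k
sub-tabulate f n i k le =
  trans (cong (take k ∘ drop i) (toList-tabulate f n)) (take-drop-applyUpTo f i le)

-- Bounds on the number of distinct factors.

windows : ∀ {n} → Vec ℕ n → ℕ → List (List ℕ)
windows {n} S k = map (λ i → sub S i k) (upTo (suc (n ∸ k)))

d≤length : ∀ {n} (S : Vec ℕ n) {k ws} → k ≤ n →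
  (∀ i → i + k ≤ n → sub S i k List.∈ ws) → d k S ≤ length ws
d≤length {n} S {k} {ws} k≤n subs∈ws = unique-⊆⇒length≤ (deduplicate-! (≡-dec _≟_) (windows S k)) dedup⊆ws
  where
  dedup⊆ws : ∀ {w} → w List.∈ deduplicate (≡-dec _≟_) (windows S k) → w List.∈ ws
  dedup⊆ws w∈ with ∈-map⁻ (λ i → sub S i k) (∈-deduplicate⁻ (≡-dec _≟_) (windows S k) w∈)
  ... | i , i∈ , refl with ∈-upTo⁻ i∈
  ...   | s≤s i≤ = subs∈ws i (m≤o∸n⇒m+n≤o i k≤n i≤)

length≤d : ∀ {n} (S : Vec ℕ n) {k ws} → Unique ws →
  (∀ {w} → w List.∈ ws → ∃ λ i → i + k ≤ n × sub S i k ≡ w) → length ws ≤ d k S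
length≤d {n} S {k} {ws} ws! occurs = unique-⊆⇒length≤ ws! ws⊆dedup
  where
  ws⊆dedup : ∀ {w} → w List.∈ ws → w List.∈ deduplicate (≡-dec _≟_) (windows S k)
  ws⊆dedup w∈ws with occurs w∈ws
  ... | i , i+k≤n , refl = ∈-deduplicate⁺ (≡-dec _≟_)
    (∈-map⁺ (λ i → sub S i k) (∈-upTo⁺ (s≤s (m+n≤o⇒m≤o∸n i i+k≤n))))

-- Lower bounds on the size of a subset.

-- Induction on `T`: the element that serves the last index serves no other, so it can be deleted
-- from `Γ`.
pigeonhole-≤∣∣ : ∀ {n} (R : ℕ → Fin n → Set) → (∀ {s s′ p} → R s p → R s′ p → s ≡ s′) →
  ∀ T (Γ : Subset n) → (∀ s → s < T → ∃ λ p → p ∈ Γ × R s p) → T ≤ ∣ Γ ∣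
pigeonhole-≤∣∣ R R-functional zero    Γ meets = z≤n
pigeonhole-≤∣∣ R R-functional (suc T) Γ meets with meets T ≤-refl
... | p , p∈Γ , RTp = ≤-trans
  (s≤s (pigeonhole-≤∣∣ R R-functional T (Γ - p) meets′))
  (x∈p⇒∣p-x∣<∣p∣ p∈Γ)
  where
  meets′ : ∀ s → s < T → ∃ λ q → q ∈ Γ - p × R s q
  meets′ s s<T with meets s (m<n⇒m<1+n s<T)
  ... | q , q∈Γ , Rsq =
    q , x∈p∧x≢y⇒x∈p-y q∈Γ (λ { refl → <⇒≢ s<T (R-functional Rsq RTp) }) , Rsq

-- Division of the positions into blocks, one per marker.

module Marks (gap : ℕ → ℕ) (gap>0 : ∀ t → 0 < gap t) where

  mark : ℕ → ℕ
  mark zero    = 0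
  mark (suc t) = mark t + gap t

  mark-mono : ∀ {t t′} → t ≤ t′ → mark t ≤ mark t′
  mark-mono {t} {t′} t≤t′ with m≤n⇒m<n∨m≡n t≤t′
  ... | inj₂ refl             = ≤-refl
  ... | inj₁ (s≤s {n = u} t≤u) = ≤-trans (mark-mono t≤u) (m≤m+n (mark u) (gap u))

  between-< : ∀ {t r t′} → r < gap t → t < t′ → mark t + r < mark t′
  between-< {t} r<gap t<t′ = <-≤-trans (+-monoʳ-< (mark t) r<gap) (mark-mono t<t′)

  locate : ∀ q → ∃₂ λ t r → r < gap t × q ≡ mark t + r
  locate zero = 0 , 0 , gap>0 0 , refl
  locate (suc q) with locate q
  ... | t , r , r<gap , refl with m≤n⇒m<n∨m≡n r<gap
  ...   | inj₁ 1+r<gap = t , suc r , 1+r<gap , sym (+-suc (mark t) r)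
  ...   | inj₂ 1+r≡gap = suc t , 0 , gap>0 (suc t) ,
    trans (sym (+-suc (mark t) r)) (trans (cong (mark t +_) 1+r≡gap) (sym (+-identityʳ _)))

  -- Distinct blocks are disjoint. This lets `W-core` evaluate `W`, which is defined through
  -- `locate`, at any position already known as marker plus offset.
  locate-unique : ∀ {t r t′ r′} → r < gap t → r′ < gap t′ →
    mark t + r ≡ mark t′ + r′ → t ≡ t′ × r ≡ r′
  locate-unique {t} {r} {t′} {r′} r<gap r′<gap eq with <-cmp t t′
  ... | tri< t<t′ _ _ =
    contradiction eq (<⇒≢ (<-≤-trans (between-< r<gap t<t′) (m≤m+n (mark t′) r′)))
  ... | tri≈ _ refl _ = refl , +-cancelˡ-≡ (mark t) r r′ eq
  ... | tri> _ _ t′<t =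
    contradiction (sym eq) (<⇒≢ (<-≤-trans (between-< r′<gap t′<t) (m≤m+n (mark t) r)))

-- A Kronecker delta in `x` and `o`, scaled by `c`. With `x` past the end of a factor it also
-- describes the all-zero factor.
pulse : ℕ → ℕ → ℕ → ℕ
pulse c zero    zero    = c
pulse c zero    (suc o) = 0
pulse c (suc x) zero    = 0
pulse c (suc x) (suc o) = pulse c x o

pulse-< : ∀ c {x o} → o < x → pulse c x o ≡ 0
pulse-< c {suc x} {zero}  _         = refl
pulse-< c {suc x} {suc o} (s≤s o<x) = pulse-< c o<x

pulse-+ : ∀ c x o → pulse c x (x + o) ≡ pulse c 0 o
pulse-+ c zero    o = refl
pulse-+ c (suc x) o = pulse-+ c x o

-- The infinite word.

module Word (e : ℕ) where

  -- Per unit of length, early windows cost 2m - 1 and pulses cost m. Rounding e / 3 down keeps the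
  -- total 3m - 1 at most δ, while `e<3*m` keeps m proportional to δ.
  m : ℕ
  m = suc (e / 3)

  -- The exponent starts at 1, so that a 0 follows every marker.
  gap : ℕ → ℕ
  gap t = 2 ^ suc (t / m)

  open Marks gap (λ t → m^n>0 2 (suc (t / m))) public

  letter : ℕ → ℕ → ℕ
  letter t = pulse (suc (t % m)) 0

  W : ℕ → ℕ
  W p with p <? e
  ... | yes _ = 2 + p
  ... | no  _ = letter (proj₁ (locate (p ∸ e))) (proj₁ (proj₂ (locate (p ∸ e))))

  W-prefix : ∀ {p} → p < e → W p ≡ 2 + p
  W-prefix {p} p<e with p <? e
  ... | yes _   = refl
  ... | no  p≮e = contradiction p<e p≮e

  W-core : ∀ {t r} → r < gap t → W (e + (mark t + r)) ≡ letter t r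
  W-core {t} {r} r<gap with e + (mark t + r) <? e
  ... | yes lt = contradiction lt (≤⇒≯ (m≤m+n e _))
  ... | no  _ rewrite m+n∸m≡n e (mark t + r) with locate (mark t + r)
  ...   | t′ , r′ , r′<gap , eq with locate-unique {t} {r} {t′} {r′} r<gap r′<gap eq
  ...     | refl , refl = refl

  W-mark : ∀ t → W (e + mark t) ≡ suc (t % m)
  W-mark t = trans (cong (λ x → W (e + x)) (sym (+-identityʳ (mark t)))) (W-core {t} (m^n>0 2 (suc (t / m))))

  -- Growth of the gaps and positions of the markers.

  e<3*m : e < 3 * m
  e<3*m = begin-strict
    e                    ≡⟨ m≡m%n+[m/n]*n e 3 ⟩
    e % 3 + e / 3 * 3    <⟨ +-monoˡ-< (e / 3 * 3) (m%n<n e 3) ⟩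
    3 + e / 3 * 3        ≡⟨ *-comm m 3 ⟩
    3 * m                ∎
    where open ≤-Reasoning

  m≤1+e : m ≤ suc e
  m≤1+e = s≤s (m/n≤m e 3)

  2≤gap : ∀ t → 2 ≤ gap t
  2≤gap t = *-monoʳ-≤ 2 (m^n>0 2 (t / m))

  [i+j*m]/m≡j : ∀ {i} j → i < m → (i + j * m) / m ≡ j
  [i+j*m]/m≡j {i} j i<m = begin
    (i + j * m) / m      ≡⟨ +-distrib-/-∣ʳ i (n∣m*n j) ⟩
    i / m + j * m / m    ≡⟨ cong₂ _+_ (m<n⇒m/n≡0 i<m) (m*n/n≡m j m) ⟩
    j                    ∎
    where open ≡-Reasoning

  -- A geometric sum: j full cycles span m (2 + 4 + ... + 2^j), and i further gaps have length
  -- 2^(j+1). Adding 2m avoids subtraction, and admitting i = m lets the end of one cycle serve as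
  -- the start of the next.
  mark-closed : ∀ j i → i ≤ m → mark (i + j * m) + 2 * m ≡ (m + i) * 2 ^ suc j
  mark-closed zero zero _ = trans (*-comm 2 m) (cong (_* 2) (sym (+-identityʳ m)))
  mark-closed (suc j) zero _ = trans (mark-closed j m ≤-refl) (doubling m (2 ^ suc j))
    where
    doubling : ∀ m g → (m + m) * g ≡ (m + 0) * (2 * g)
    doubling = solve-∀
  mark-closed j (suc i) i<m = begin
    mark (i + j * m) + gap (i + j * m) + 2 * m
      ≡⟨ cong (λ x → mark (i + j * m) + 2 ^ suc x + 2 * m) ([i+j*m]/m≡j j i<m) ⟩
    mark (i + j * m) + 2 ^ suc j + 2 * m
      ≡⟨ rearrange₁ (mark (i + j * m)) (2 ^ suc j) (2 * m) ⟩
    (mark (i + j * m) + 2 * m) + 2 ^ suc j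
      ≡⟨ cong (_+ 2 ^ suc j) (mark-closed j i (<⇒≤ i<m)) ⟩
    (m + i) * 2 ^ suc j + 2 ^ suc j
      ≡⟨ rearrange₂ m i (2 ^ suc j) ⟩
    (m + suc i) * 2 ^ suc j ∎
    where
    open ≡-Reasoning
    rearrange₁ : ∀ x g y → x + g + y ≡ (x + y) + g
    rearrange₁ = solve-∀
    rearrange₂ : ∀ m i g → (m + i) * g + g ≡ (m + suc i) * g
    rearrange₂ = solve-∀

  mark+2*m : ∀ t → mark t + 2 * m ≡ (m + t % m) * gap t
  mark+2*m t = begin
    mark t + 2 * m                      ≡⟨ cong (λ x → mark x + 2 * m) (m≡m%n+[m/n]*n t m) ⟩
    mark (t % m + t / m * m) + 2 * m    ≡⟨ mark-closed (t / m) (t % m) (<⇒≤ (m%n<n t m)) ⟩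
    (m + t % m) * gap t                 ∎
    where open ≡-Reasoning

  -- 2m - 1
  c : ℕ
  c = m + e / 3

  -- By `mark+2*m` a marker lies at no more than (2m - 1) times its gap, less 2m. A gap of at most 1
  -- + κ would thus put it strictly below `c * κ`.
  c*κ≤mark⇒2+κ≤gap : ∀ {κ t} → c * κ ≤ mark t → 2 + κ ≤ gap t
  c*κ≤mark⇒2+κ≤gap {κ} {t} cκ≤mark = ≰⇒> λ gap≤1+κ → <-irrefl refl (begin-strict
    mark t + c              <⟨ +-monoʳ-< (mark t) (+-monoʳ-< m (≤-reflexive (sym (+-identityʳ m)))) ⟩
    mark t + 2 * m          ≡⟨ mark+2*m t ⟩
    (m + t % m) * gap t     ≤⟨ *-mono-≤ (+-monoʳ-≤ m (≤-pred (m%n<n t m))) gap≤1+κ ⟩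
    c * suc κ               ≡⟨ *-suc c κ ⟩
    c + c * κ               ≤⟨ +-monoʳ-≤ c cκ≤mark ⟩
    c + mark t              ≡⟨ +-comm c (mark t) ⟩
    mark t + c              ∎)
    where open ≤-Reasoning

  -- Counting the factors of length at least 2.

  -- The first marker at or after `q` also lies beyond the threshold, so its gap is at least the
  -- length of the window and no second marker is reached.
  late-window-pulse : ∀ κ q → c * κ ≤ q →
    ∃₂ λ t x → ∀ o → o < 2 + κ → W (e + q + o) ≡ pulse (suc (t % m)) x o
  late-window-pulse κ q cκ≤q with locate q
  ... | t , zero , _ , refl rewrite +-identityʳ (mark t) = t , 0 , λ o o<k →
    trans (cong W (+-assoc e (mark t) o)) (W-core {t} (<-≤-trans o<k (c*κ≤mark⇒2+κ≤gap {t = t} cκ≤q)))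
  -- The window starts strictly inside a gap, at distance `x` from the next marker; that marker may
  -- lie outside the window.
  ... | t , suc r , r<gap , refl = suc t , x , window
    where
    x = gap t ∸ suc r
    r+x≡gap : suc r + x ≡ gap t
    r+x≡gap = m+[n∸m]≡n (<⇒≤ r<gap)
    gap-bound : 2 + κ ≤ gap (suc t)
    gap-bound = c*κ≤mark⇒2+κ≤gap {t = suc t} (≤-trans cκ≤q (+-monoʳ-≤ (mark t) (<⇒≤ r<gap)))
    window : ∀ o → o < 2 + κ → W (e + (mark t + suc r) + o) ≡ pulse (suc (suc t % m)) x o
    window o o<k with o <? x
    ... | yes o<x = begin
      W (e + (mark t + suc r) + o)
        ≡⟨ cong W (trans (+-assoc e _ o) (cong (e +_) (+-assoc (mark t) (suc r) o))) ⟩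
      W (e + (mark t + (suc r + o)))
        ≡⟨ W-core {t} (subst (suc r + o <_) r+x≡gap (+-monoʳ-< (suc r) o<x)) ⟩
      letter t (suc r + o)
        ≡⟨ pulse-< _ o<x ⟨
      pulse (suc (suc t % m)) x o ∎
      where open ≡-Reasoning
    ... | no o≮x with m≤n⇒∃[o]m+o≡n (≮⇒≥ o≮x)
    ...   | y , refl = begin
      W (e + (mark t + suc r) + (x + y))
        ≡⟨ cong W (rearrange e (mark t) (suc r) x y) ⟩
      W (e + (mark t + (suc r + x) + y))
        ≡⟨ cong (λ g → W (e + (mark t + g + y))) r+x≡gap ⟩
      W (e + (mark (suc t) + y))
        ≡⟨ W-core {suc t} (<-≤-trans (≤-<-trans (m≤n+m y x) o<k) gap-bound) ⟩
      letter (suc t) y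
        ≡⟨ pulse-+ _ x y ⟨
      pulse (suc (suc t % m)) x (x + y) ∎
      where
      open ≡-Reasoning
      rearrange : ∀ e p r x y → e + (p + r) + (x + y) ≡ e + (p + (r + x) + y)
      rearrange = solve-∀

  word : ℕ → ℕ → List ℕ
  word p k = applyUpTo (λ o → W (p + o)) k

  -- Here κ is the length minus 2: at length 2 the threshold `c * κ` vanishes, as every gap is
  -- already at least 2.
  early pulses candidates : ℕ → List (List ℕ)
  early κ = map (λ p → word p (2 + κ)) (upTo (e + c * κ))
  pulses κ = cartesianProductWith (λ a x → applyUpTo (pulse a x) (2 + κ)) (applyUpTo suc m) (upTo (2 + κ))
  candidates κ = applyUpTo (λ _ → 0) (2 + κ) ∷ early κ ++ pulses κ

  word∈candidates : ∀ κ p → word p (2 + κ) List.∈ candidates κ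
  word∈candidates κ p with p <? e + c * κ
  ... | yes p<  = there (∈-++⁺ˡ (∈-map⁺ (λ p → word p (2 + κ)) (∈-upTo⁺ p<)))
  ... | no  p≮ with m≤n⇒∃[o]m+o≡n (m+n≤o⇒m≤o e (≮⇒≥ p≮))
  ...   | q , refl with late-window-pulse κ q (+-cancelˡ-≤ e _ _ (≮⇒≥ p≮))
  ...     | t , x , window with x <? 2 + κ
  ...       | yes x<k = there (∈-++⁺ʳ (early κ) (subst (List._∈ pulses κ)
                (sym (applyUpTo-cong (2 + κ) window))
                (∈-cartesianProductWith⁺ (λ a x → applyUpTo (pulse a x) (2 + κ))
                  (∈-applyUpTo⁺ suc (m%n<n t m)) (∈-upTo⁺ x<k))))
  ...       | no  x≮k = here (applyUpTo-cong (2 + κ) (λ o o<k →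
                trans (window o o<k) (pulse-< _ (<-≤-trans o<k (≮⇒≥ x≮k)))))

  -- With h = e / 3 the constant part is 3 + e + 2h ≤ 2δ - 1 and the coefficient of κ is 2 + 3h ≤ δ.
  length-candidates : ∀ κ → length (candidates κ) ≤ (2 + e) * (2 + κ)
  length-candidates κ = begin
    length (candidates κ)
      ≡⟨ cong suc (length-++ (early κ)) ⟩
    suc (length (early κ) + length (pulses κ))
      ≡⟨ cong₂ (λ x y → suc (x + y))
           (trans (length-map (λ p → word p (2 + κ)) (upTo (e + c * κ))) (length-upTo (e + c * κ)))
           (trans (length-cartesianProductWith _ (applyUpTo suc m) (upTo (2 + κ)))
             (cong₂ _*_ (length-applyUpTo suc m) (length-upTo (2 + κ)))) ⟩
    suc (e + c * κ + m * (2 + κ))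
      ≡⟨ expand e (e / 3) κ ⟩
    (3 + e + 2 * (e / 3)) + (2 + e / 3 * 3) * κ
      ≤⟨ +-mono-≤ (+-monoʳ-≤ (3 + e) 2*h≤e) (*-monoˡ-≤ κ (+-monoʳ-≤ 2 h*3≤e)) ⟩
    (3 + e + e) + (2 + e) * κ
      ≤⟨ n≤1+n _ ⟩
    suc ((3 + e + e) + (2 + e) * κ)
      ≡⟨ contract e κ ⟩
    (2 + e) * (2 + κ) ∎
    where
    open ≤-Reasoning
    h*3≤e : e / 3 * 3 ≤ e
    h*3≤e = m/n*n≤m e 3
    2*h≤e : 2 * (e / 3) ≤ e
    2*h≤e = ≤-trans (≤-reflexive (*-comm 2 (e / 3))) (≤-trans (*-monoʳ-≤ (e / 3) (n≤1+n 2)) h*3≤e)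
    expand : ∀ e h κ → suc (e + (suc h + h) * κ + suc h * (2 + κ)) ≡ (3 + e + 2 * h) + (2 + h * 3) * κ
    expand = solve-∀
    contract : ∀ e κ → suc ((3 + e + e) + (2 + e) * κ) ≡ (2 + e) * (2 + κ)
    contract = solve-∀

  -- The alphabet and the exact value of δ.

  letter<δ : ∀ t r → letter t r < 2 + e
  letter<δ t zero    = s≤s (≤-trans (m%n<n t m) m≤1+e)
  letter<δ t (suc r) = z<s

  W<δ : ∀ p → W p < 2 + e
  W<δ p with p <? e
  ... | yes p<e = s≤s (s≤s p<e)
  ... | no  _   = letter<δ (proj₁ (locate (p ∸ e))) (proj₁ (proj₂ (locate (p ∸ e))))

  -- The first marker carries 1 and is followed by 0; the other letters form the initial segment.
  -- All witnesses lie among the first δ positions, hence inside every prefix of length n ≥ δ.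
  letter-occurs : ∀ {a} → a < 2 + e → ∃ λ p → p < 2 + e × W p ≡ a
  letter-occurs {zero}        _              = e + 1 , ≤-reflexive (cong suc (+-comm e 1)) , W-core {0} {1} (2≤gap 0)
  letter-occurs {suc zero}    _              = e + 0 , s≤s (≤-trans (≤-reflexive (+-identityʳ e)) (n≤1+n e)) , W-mark 0
  letter-occurs {suc (suc p)} (s≤s (s≤s p<e)) = p , m<n⇒m<1+n (m<n⇒m<1+n p<e) , W-prefix p<e

  prefix : ∀ n → Vec ℕ n
  prefix n = tabulate (W ∘ toℕ)

  d≤ : ∀ n k → 1 ≤ k → k ≤ n → d k (prefix n) ≤ (2 + e) * k
  d≤ n (suc zero) _ 1≤n = begin
    d 1 (prefix n)                     ≤⟨ d≤length (prefix n) {ws = applyUpTo [_] (2 + e)} 1≤n singleton∈ ⟩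
    length (applyUpTo [_] (2 + e))     ≡⟨ length-applyUpTo [_] (2 + e) ⟩
    2 + e                              ≡⟨ *-identityʳ (2 + e) ⟨
    (2 + e) * 1                        ∎
    where
    open ≤-Reasoning
    singleton∈ : ∀ i → i + 1 ≤ n → sub (prefix n) i 1 List.∈ applyUpTo [_] (2 + e)
    singleton∈ i i<n = subst (List._∈ applyUpTo [_] (2 + e)) (sym (sub-tabulate W n i 1 i<n))
      (∈-applyUpTo⁺ [_] (W<δ (i + 0)))
  d≤ n (suc (suc κ)) _ k≤n = ≤-trans
    (d≤length (prefix n) {ws = candidates κ} k≤n (λ i i+k≤n →
      subst (List._∈ candidates κ) (sym (sub-tabulate W n i (2 + κ) i+k≤n)) (word∈candidates κ i)))
    (length-candidates κ)

  d₁≥ : ∀ n → 2 + e ≤ n → 2 + e ≤ d 1 (prefix n)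
  d₁≥ n δ≤n = ≤-trans (≤-reflexive (sym (length-applyUpTo [_] (2 + e))))
    (length≤d (prefix n) singletons! occurs)
    where
    singletons! : Unique (applyUpTo [_] (2 + e))
    singletons! = Unique.applyUpTo⁺₁ [_] (2 + e) (λ i<j _ eq → <⇒≢ i<j (∷-injectiveˡ eq))
    occurs : ∀ {w} → w List.∈ applyUpTo [_] (2 + e) → ∃ λ i → i + 1 ≤ n × sub (prefix n) i 1 ≡ w
    occurs w∈ with ∈-applyUpTo⁻ [_] w∈
    ... | a , a<δ , refl with letter-occurs a<δ
    ...   | p , p<δ , refl = p , p+1≤n ,
      trans (sub-tabulate W n p 1 p+1≤n) (cong (λ x → [ W x ]) (+-identityʳ p))
      where
      p+1≤n : p + 1 ≤ n
      p+1≤n = ≤-trans (≤-reflexive (+-comm p 1)) (≤-trans p<δ δ≤n)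

  hasDelta : ∀ n → 2 + e ≤ n → HasDelta (prefix n) (2 + e)
  -- The maximum is attained at k = 1, where all δ letters are counted.
  hasDelta n δ≤n = d≤ n , 1 , ≤-refl , 1≤n ,
    ≤-antisym (d≤ n 1 ≤-refl 1≤n) (≤-trans (≤-reflexive (*-identityʳ (2 + e))) (d₁≥ n δ≤n))
    where
    1≤n : 1 ≤ n
    1≤n = ≤-trans (s≤s z≤n) δ≤n

  -- Uniqueness of the factors from one marker to the next.

  letter-0 : ∀ t {r} → 0 < r → letter t r ≡ 0
  letter-0 t z<s = refl

  gap-injective : ∀ {t t′} → gap t ≡ gap t′ → t / m ≡ t′ / m
  gap-injective {t} {t′} eq with <-cmp (t / m) (t′ / m)
  ... | tri< lt _ _ = contradiction eq (<⇒≢ (^-monoʳ-< 2 (s≤s z<s) (s≤s lt)))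
  ... | tri≈ _ eq′ _ = eq′
  ... | tri> _ _ gt = contradiction (sym eq) (<⇒≢ (^-monoʳ-< 2 (s≤s z<s) (s≤s gt)))

  -- The letter of a marker reveals the residue of its index, and the gap after it reveals the
  -- quotient.
  mark-determined : ∀ {t t′} → t % m ≡ t′ % m → t / m ≡ t′ / m → t ≡ t′
  mark-determined {t} {t′} eq% eq/ = begin
    t                      ≡⟨ m≡m%n+[m/n]*n t m ⟩
    t % m + t / m * m      ≡⟨ cong₂ (λ x y → x + y * m) eq% eq/ ⟩
    t′ % m + t′ / m * m    ≡⟨ m≡m%n+[m/n]*n t′ m ⟨
    t′                     ∎
    where open ≡-Reasoning

  W≢0-upto-e : ∀ {p} → p ≤ e → W p ≢ 0
  W≢0-upto-e p≤e Wp≡0 with m≤n⇒m<n∨m≡n p≤e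
  ... | inj₁ p<e = 1+n≢0 (trans (sym (W-prefix p<e)) Wp≡0)
  ... | inj₂ refl = 1+n≢0 (trans (sym (W-mark 0)) (trans (cong W (+-identityʳ e)) Wp≡0))

  -- The prefix contains marker letters too, but no 0, and every gap is at least 2.
  mark-to-mark-unique : ∀ t i → (∀ o → o < suc (gap t) → W (i + o) ≡ W (e + mark t + o)) → i ≡ e + mark t
  mark-to-mark-unique t i same with m≤n⇒∃[o]m+o≡n e≤i
    where
    W1≡0 : W (i + 1) ≡ 0
    W1≡0 = trans (same 1 (s≤s (≤-trans (n≤1+n 1) (2≤gap t))))
      (trans (cong W (+-assoc e (mark t) 1)) (W-core {t} (2≤gap t)))
    e≤i : e ≤ i
    e≤i = ≮⇒≥ (λ i<e → W≢0-upto-e (≤-trans (≤-reflexive (+-comm i 1)) i<e) W1≡0)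
  ... | q , refl with locate q
  ...   | t′ , r , r<gap , refl = cong (e +_) (equal r r<gap same)
    where
    -- The factor begins with a nonzero letter, so it cannot start at a positive offset inside a
    -- gap.
    equal : ∀ r → r < gap t′ →
      (∀ o → o < suc (gap t) → W (e + (mark t′ + r) + o) ≡ W (e + mark t + o)) → mark t′ + r ≡ mark t
    equal (suc r) r<gap same = contradiction
      (trans (sym (W-core {t′} r<gap)) (trans (cong W (sym (+-identityʳ _)))
        (trans (same 0 z<s) (trans (cong W (+-identityʳ _)) (W-mark t)))))
      0≢1+n
    equal zero 0<gap′ same rewrite +-identityʳ (mark t′) = cong mark t′≡t
      where
      same% : t′ % m ≡ t % m
      same% = suc-injective (trans (sym (W-mark t′)) (trans (cong W (sym (+-identityʳ _)))
        (trans (same 0 z<s) (trans (cong W (+-identityʳ _)) (W-mark t)))))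
      -- If the gaps differed, the marker closing the shorter one would be matched with a 0 of the
      -- longer one. The factor has length `suc (gap t)` in order to include its closing marker.
      same-gap : gap t′ ≡ gap t
      same-gap with <-cmp (gap t′) (gap t)
      ... | tri< lt _ _ = contradiction
        (trans (sym (W-core {t} lt)) (trans (cong W (sym (+-assoc e (mark t) (gap t′))))
          (trans (sym (same (gap t′) (m<n⇒m<1+n lt)))
            (trans (cong W (+-assoc e (mark t′) (gap t′))) (W-mark (suc t′))))))
        (λ eq → 0≢1+n (trans (sym (letter-0 t 0<gap′)) eq))
      ... | tri≈ _ eq _ = eq
      ... | tri> _ _ gt = contradiction
        (trans (sym (W-core {t′} gt)) (trans (cong W (sym (+-assoc e (mark t′) (gap t))))
          (trans (same (gap t) ≤-refl)
            (trans (cong W (+-assoc e (mark t) (gap t))) (W-mark (suc t))))))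
        (λ eq → 0≢1+n (trans (sym (letter-0 t′ (m^n>0 2 (suc (t / m))))) eq))
      t′≡t : t′ ≡ t
      t′≡t = mark-determined same% (gap-injective {t′} {t} same-gap)

  -- Markers that fit into length n, and disjoint gaps.

  -- By `mark-closed` the claim is 1 + e + mX ≤ n + 2m for X = 2^(j+1). Write 1 + e = m + v: then m
  -- ≤ 2m and v ≤ (1 + v) X, and (1 + v) X + mX = δX.
  mark-fits : ∀ {n} j → (2 + e) * 2 ^ suc j ≤ n → e + mark (j * m) < n
  mark-fits {n} j δX≤n with m≤n⇒∃[o]m+o≡n m≤1+e
  ... | v , m+v≡1+e = +-cancelʳ-≤ (2 * m) _ _ (begin
    suc e + mark (j * m) + 2 * m      ≡⟨ +-assoc (suc e) (mark (j * m)) (2 * m) ⟩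
    suc e + (mark (j * m) + 2 * m)    ≡⟨ cong₂ _+_ (sym m+v≡1+e) (mark-closed j 0 z≤n) ⟩
    m + v + (m + 0) * X               ≤⟨ +-monoˡ-≤ ((m + 0) * X) (+-mono-≤ (m≤m+n m (m + 0)) v≤[1+v]*X) ⟩
    2 * m + suc v * X + (m + 0) * X   ≡⟨ rearrange m v X ⟩
    suc (m + v) * X + 2 * m           ≡⟨ cong (λ x → suc x * X + 2 * m) m+v≡1+e ⟩
    (2 + e) * X + 2 * m               ≤⟨ +-monoˡ-≤ (2 * m) δX≤n ⟩
    n + 2 * m                         ∎)
    where
    open ≤-Reasoning
    X = 2 ^ suc j
    v≤[1+v]*X : v ≤ suc v * X
    v≤[1+v]*X = ≤-trans (n≤1+n v) (m≤m*n (suc v) X {{m^n≢0 2 (suc j)}})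
    rearrange : ∀ m v X → 2 * m + suc v * X + (m + 0) * X ≡ suc (m + v) * X + 2 * m
    rearrange = solve-∀

  -- Neighbouring factors share a marker; taking every second one makes the closed intervals
  -- disjoint, as 2s + 1 < 2s′.
  even-gaps-disjoint : ∀ {s s′} → s < s′ → e + mark (suc (s + s)) < e + mark (s′ + s′)
  even-gaps-disjoint {s} {s′} s<s′ = +-monoʳ-< e (subst (_< mark (s′ + s′)) (+-identityʳ _)
    (between-< {suc (s + s)} {0} (m^n>0 2 (suc (suc (s + s) / m)))
      (≤-trans (≤-reflexive (cong suc (sym (+-suc s s)))) (+-mono-≤ s<s′ s<s′))))

  -- Lower bounds on the size of an attractor.

  module _ {n} (δ≤n : 2 + e ≤ n) (Γ : Subset n) (attracts : IsAttractor (prefix n) Γ) where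

    occurrence : ∀ i k → 1 ≤ k → i + k ≤ n → ∃ λ i′ → (∀ o → o < k → W (i′ + o) ≡ W (i + o)) ×
      ∃ λ (p : Fin n) → p ∈ Γ × i′ ≤ toℕ p × toℕ p < i′ + k
    occurrence i k 1≤k i+k≤n with attracts i k 1≤k i+k≤n
    ... | i′ , i′+k≤n , eq , hit = i′ ,
      applyUpTo-injective k (trans (sym (sub-tabulate W n i′ k i′+k≤n)) (trans eq (sub-tabulate W n i k i+k≤n))) ,
      hit

    -- An occurrence of a single letter is met only at its own position, so `Γ` holds a position of
    -- every letter.
    δ≤∣Γ∣ : 2 + e ≤ ∣ Γ ∣
    δ≤∣Γ∣ = pigeonhole-≤∣∣ (λ a p → W (toℕ p) ≡ a) (λ { refl refl → refl }) (2 + e) Γ meets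
      where
      meets : ∀ a → a < 2 + e → ∃ λ p → p ∈ Γ × W (toℕ p) ≡ a
      meets a a<δ with letter-occurs a<δ
      ... | i , i<δ , refl with occurrence i 1 ≤-refl (≤-trans (≤-reflexive (+-comm i 1)) (≤-trans i<δ δ≤n))
      ...   | i′ , same , p , p∈Γ , i′≤p , p<i′+1 = p , p∈Γ , (begin
        W (toℕ p)    ≡⟨ cong W (≤-antisym (≤-pred (≤-trans p<i′+1 (≤-reflexive (+-comm i′ 1)))) i′≤p) ⟩
        W i′         ≡⟨ cong W (+-identityʳ i′) ⟨
        W (i′ + 0)   ≡⟨ same 0 z<s ⟩
        W (i + 0)    ≡⟨ cong W (+-identityʳ i) ⟩
        W i          ∎)
        where open ≡-Reasoning

    Between : ℕ → Fin n → Set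
    Between t p = e + mark t ≤ toℕ p × toℕ p ≤ e + mark (suc t)

    meets-Between : ∀ t → e + mark (suc t) < n → ∃ λ p → p ∈ Γ × Between t p
    meets-Between t fits with occurrence (e + mark t) (suc (gap t)) z<s (≤-trans (≤-reflexive end) fits)
      where
      end : e + mark t + suc (gap t) ≡ suc (e + mark (suc t))
      end = trans (+-suc (e + mark t) (gap t)) (cong suc (+-assoc e (mark t) (gap t)))
    ... | i′ , same , p , p∈Γ , i′≤p , p<end with mark-to-mark-unique t i′ same
    ...   | refl = p , p∈Γ , i′≤p , ≤-pred (≤-trans p<end (≤-reflexive
      (trans (+-suc (e + mark t) (gap t)) (cong suc (+-assoc e (mark t) (gap t))))))

    Between-even-functional : ∀ {s s′ p} → Between (s + s) p → Between (s′ + s′) p → s ≡ s′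
    Between-even-functional {s} {s′} (lo , hi) (lo′ , hi′) with <-cmp s s′
    ... | tri< s<s′ _ _ = contradiction (≤-trans lo′ hi) (<⇒≱ (even-gaps-disjoint s<s′))
    ... | tri≈ _ eq _   = eq
    ... | tri> _ _ s′<s = contradiction (≤-trans lo hi′) (<⇒≱ (even-gaps-disjoint s′<s))

    -- Each of the ⌊K/2⌋ factors starting at markers 0, 2, 4, ... claims its own element of `Γ`; the
    -- extra 1 pays for odd K.
    marks≤ : ∀ K → e + mark K < n → K ≤ suc (2 * ∣ Γ ∣)
    marks≤ K fits = begin
      K                        ≡⟨ ⌊n/2⌋+⌈n/2⌉≡n K ⟨
      ⌊ K /2⌋ + ⌈ K /2⌉        ≤⟨ +-monoʳ-≤ ⌊ K /2⌋ (⌊n/2⌋-mono (n≤1+n (suc K))) ⟩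
      ⌊ K /2⌋ + suc ⌊ K /2⌋    ≤⟨ +-mono-≤ half≤ (s≤s half≤) ⟩
      ∣ Γ ∣ + suc ∣ Γ ∣        ≡⟨ rearrange ∣ Γ ∣ ⟩
      suc (2 * ∣ Γ ∣)          ∎
      where
      open ≤-Reasoning
      rearrange : ∀ x → x + suc x ≡ suc (2 * x)
      rearrange = solve-∀
      1+2s≤K : ∀ {s} → s < ⌊ K /2⌋ → suc (s + s) ≤ K
      1+2s≤K {s} s<h = begin
        suc (s + s)           ≤⟨ +-mono-≤ s<h (<⇒≤ s<h) ⟩
        ⌊ K /2⌋ + ⌊ K /2⌋     ≤⟨ +-monoʳ-≤ ⌊ K /2⌋ (⌊n/2⌋≤⌈n/2⌉ K) ⟩
        ⌊ K /2⌋ + ⌈ K /2⌉     ≡⟨ ⌊n/2⌋+⌈n/2⌉≡n K ⟩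
        K                     ∎
      half≤ : ⌊ K /2⌋ ≤ ∣ Γ ∣
      half≤ = pigeonhole-≤∣∣ (λ s → Between (s + s)) Between-even-functional ⌊ K /2⌋ Γ
        (λ s s<h → meets-Between (s + s) (≤-<-trans (+-monoʳ-≤ e (mark-mono (1+2s≤K s<h))) fits))

    -- The constant is 20 = 2 + 6 · 3: two copies of δ are paid by `δ≤∣Γ∣`, and the other j cost at
    -- most 6jm, where jm ≤ 1 + 2∣Γ∣ ≤ 3∣Γ∣.
    [1+J]*δ≤20*∣Γ∣ : ∀ J → (2 + e) * 2 ^ J ≤ n → suc J * (2 + e) ≤ 20 * ∣ Γ ∣
    [1+J]*δ≤20*∣Γ∣ zero _ = ≤-trans (≤-reflexive (*-identityˡ (2 + e)))
      (≤-trans δ≤∣Γ∣ (m≤m+n ∣ Γ ∣ _))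
    [1+J]*δ≤20*∣Γ∣ (suc j) δX≤n = begin
      (2 + j) * (2 + e)                  ≡⟨ split j e ⟩
      2 * (2 + e) + j * (2 + e)          ≤⟨ +-mono-≤ (*-monoʳ-≤ 2 δ≤∣Γ∣) (*-monoʳ-≤ j δ≤6m) ⟩
      2 * ∣ Γ ∣ + j * (6 * m)            ≡⟨ cong (2 * ∣ Γ ∣ +_) (commute j m) ⟩
      2 * ∣ Γ ∣ + 6 * (j * m)            ≤⟨ +-monoʳ-≤ (2 * ∣ Γ ∣) (*-monoʳ-≤ 6 (marks≤ (j * m) (mark-fits j δX≤n))) ⟩
      2 * ∣ Γ ∣ + 6 * suc (2 * ∣ Γ ∣)    ≤⟨ +-monoʳ-≤ (2 * ∣ Γ ∣) (*-monoʳ-≤ 6 (+-monoˡ-≤ (2 * ∣ Γ ∣) (≤-trans (s≤s z≤n) δ≤∣Γ∣))) ⟩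
      2 * ∣ Γ ∣ + 6 * (∣ Γ ∣ + 2 * ∣ Γ ∣) ≡⟨ collect ∣ Γ ∣ ⟩
      20 * ∣ Γ ∣                         ∎
      where
      open ≤-Reasoning
      split : ∀ j e → (2 + j) * (2 + e) ≡ 2 * (2 + e) + j * (2 + e)
      split = solve-∀
      commute : ∀ j m → j * (6 * m) ≡ 6 * (j * m)
      commute = solve-∀
      collect : ∀ x → 2 * x + 6 * (x + 2 * x) ≡ 20 * x
      collect = solve-∀
      double : ∀ m → 3 * m + 3 * m ≡ 6 * m
      double = solve-∀
      δ≤6m : 2 + e ≤ 6 * m
      δ≤6m = begin
        2 + e          ≡⟨ +-comm 2 e ⟩
        e + 2          ≤⟨ +-mono-≤ (<⇒≤ e<3*m) (≤-trans (n≤1+n 2) (m≤m*n 3 m)) ⟩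
        3 * m + 3 * m  ≡⟨ double m ⟩
        6 * m          ∎

-- From integer bounds to the logarithm.

-- J is the integer part of log (n / δ) for n = δ + x. In the induction on x it grows exactly when n
-- reaches δ 2^(J+1).
dyadic-bracket : ∀ δ x → 1 ≤ δ → ∃ λ J → δ * 2 ^ J ≤ δ + x × δ + x < δ * 2 ^ suc J
dyadic-bracket δ zero 1≤δ = 0 , ≤-reflexive (trans (*-identityʳ δ) (sym (+-identityʳ δ))) ,
  subst (_< δ * 2) (trans (*-identityʳ δ) (sym (+-identityʳ δ))) (*-monoʳ-< δ {{>-nonZero 1≤δ}} (n<1+n 1))
dyadic-bracket δ (suc x) 1≤δ with dyadic-bracket δ x 1≤δ
... | J , lo , hi with m≤n⇒m<n∨m≡n hi
...   | inj₁ lt = J , ≤-trans lo (+-monoʳ-≤ δ (n≤1+n x)) , subst (_< δ * 2 ^ suc J) (sym (+-suc δ x)) lt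
...   | inj₂ eq = suc J , ≤-reflexive (trans (sym eq) (sym (+-suc δ x))) ,
  subst (_< δ * 2 ^ suc (suc J)) (trans (sym eq) (sym (+-suc δ x)))
    (*-monoʳ-< δ {{>-nonZero 1≤δ}} (^-monoʳ-< 2 (s≤s z<s) (n<1+n (suc J))))

^-distribʳ-* : ∀ m n o → (m * n) ^ o ≡ m ^ o * n ^ o
^-distribʳ-* m n zero    = refl
^-distribʳ-* m n (suc o) = trans (cong (m * n *_) (^-distribʳ-* m n o)) (interchange m n (m ^ o) (n ^ o))
  where
  interchange : ∀ a b c d → a * b * (c * d) ≡ a * c * (b * d)
  interchange = solve-∀

theorem1 : ∃ λ (p : ℕ) → ∃ λ (q : ℕ) → 1 ≤ p × 1 ≤ q ×
    (∀ (n δ : ℕ) → 2 ≤ δ → δ ≤ n →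
    ∃ λ (S : Vec ℕ n) → HasDelta S δ ×
    (∀ (Γ : Subset n) → IsAttractor S Γ →
    n ^ (p * δ) ≤ 2 ^ (q * ∣ Γ ∣) * δ ^ (p * δ)))
-- The constant is c = p / q = 1/20: after taking logarithms the inequality reads δ log (n / δ) ≤ 20
-- ∣Γ∣.
theorem1 = 1 , 20 , ≤-refl , z<s ,
  λ { n (suc (suc e)) (s≤s (s≤s z≤n)) δ≤n → Word.prefix e n , Word.hasDelta e n δ≤n , bound n e δ≤n }
  where
  bound : ∀ n e → 2 + e ≤ n → (Γ : Subset n) → IsAttractor (Word.prefix e n) Γ →
    n ^ (1 * (2 + e)) ≤ 2 ^ (20 * ∣ Γ ∣) * (2 + e) ^ (1 * (2 + e))
  bound n e δ≤n Γ attracts with m≤n⇒∃[o]m+o≡n δ≤n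
  ... | x , refl with dyadic-bracket (2 + e) x z<s
  ...   | J , lo , hi = begin
    -- Here log (n / δ) is rounded up to J + 1, so the attractor bound is needed for 1 + J copies of
    -- δ.
    n ^ (1 * δ)                          ≤⟨ ^-monoˡ-≤ (1 * δ) (<⇒≤ hi) ⟩
    (δ * 2 ^ suc J) ^ (1 * δ)            ≡⟨ cong ((δ * 2 ^ suc J) ^_) (*-identityˡ δ) ⟩
    (δ * 2 ^ suc J) ^ δ                  ≡⟨ ^-distribʳ-* δ (2 ^ suc J) δ ⟩
    δ ^ δ * (2 ^ suc J) ^ δ              ≡⟨ cong (δ ^ δ *_) (^-*-assoc 2 (suc J) δ) ⟩
    δ ^ δ * 2 ^ (suc J * δ)              ≤⟨ *-monoʳ-≤ (δ ^ δ) (^-monoʳ-≤ 2 (Word.[1+J]*δ≤20*∣Γ∣ e δ≤n Γ attracts J lo)) ⟩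
    δ ^ δ * 2 ^ (20 * ∣ Γ ∣)             ≡⟨ *-comm (δ ^ δ) _ ⟩
    2 ^ (20 * ∣ Γ ∣) * δ ^ δ             ≡⟨ cong (λ y → 2 ^ (20 * ∣ Γ ∣) * δ ^ y) (*-identityˡ δ) ⟨
    2 ^ (20 * ∣ Γ ∣) * δ ^ (1 * δ)       ∎
    where
    open ≤-Reasoning
    δ = 2 + e
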